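{- For all integers $n\ge2$ and $d$, the $(n-1)\times(n-1)$ matrix $P(n,d)=\bigl(p_{n,d}(i,j)\bigr)_{i,j=1}^{n-1}$ is symmetric and Toeplitz, i.e. $p_{n,d}(i,j)=p_{n,d}(j,i)$ for all $i,j\in[n-1]$ and $p_{n,d}(i+1,j+1)=p_{n,d}(i,j)$ for all $i,j\in[n-2]$.
   Context: A cycle $(c_1c_2\cdots c_k)$ of a permutation means $c_1\mapsto c_2\mapsto\cdots\mapsto c_k\mapsto c_1$. Its cyclic descent number is $\operatorname{cdes}(c)=\lvert\{t\in[k]: c_t>c_{t+1}\}\rvert$ and its cyclic ascent number $\operatorname{casc}(c)=\lvert\{t\in[k]: c_t<c_{t+1}\}\rvert$, where $c_{k+1}=c_1$; its cyclic weight is $w(c)=\min(\operatorname{cdes}(c),\operatorname{casc}(c))$, and the cyclic weight $w(\pi)$ of a permutation $\pi$ is the sum of the cyclic weights of all its cycles. An odd order permutation is one all of whose cycles have odd length. $\mathscr{P}_{n,d}$ is the set of odd order permutations of $[n]$ with cyclic weight $d$, and $p_{n,d}(i,j)$ is the number of $\pi\in\mathscr{P}_{n,d}$ containing $i\,n\,j$ as a cyclic factor, i.e. some cycle of $\pi$, written starting at a suitable element, contains $i,n,j$ consecutively (equivalently $\pi(i)=n$ and $\pi(n)=j$). -}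

module Defs where

open import Data.Fin.Base using (Fin; zero; suc; _<_; _≤_; inject₁; fromℕ; punchIn)
open import Data.Fin.Permutation
  using (Permutation′; _⟨$⟩ʳ_; _≈_; insert; remove; insert-remove)
  renaming (id to idₚ)
open import Data.Fin.Properties using (_≟_; _<?_; _≤?_; punchIn-injective)
open import Data.Integer.Base using (ℤ; +_)
import Data.Integer.Properties as ℤ
open import Data.List.Base
  using (List; []; _∷_; _∷ʳ_; allFin; cartesianProductWith; filter; iterate;
         length; map; takeWhile; zip)
open import Data.List.Relation.Unary.All as All using (All; [])
open import Data.List.Membership.Propositional.Properties using (∈-allFin)
open import Data.List.Relation.Unary.Any using (Any; here)
import Data.List.Relation.Unary.Any.Properties as Any
import Data.List.Relation.Unary.Unique.Setoid.Properties as Unique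
open import Data.List.Relation.Unary.Unique.Propositional.Properties using (allFin⁺)
open import Data.List.Relation.Unary.AllPairs using (AllPairs; []; _∷_)
open import Data.Nat.Base using (ℕ; zero; suc; pred; _⊓_; _%_)
open import Data.Nat.ListAction using (sum)
import Data.Nat.Properties as ℕ
open import Data.Product.Base using (_×_; _,_)
open import Relation.Binary.Bundles using (Setoid)
open import Relation.Binary.PropositionalEquality
  using (_≡_; refl; sym; trans; cong; setoid)
open import Relation.Nullary.Decidable using (Dec; ¬?; _×-dec_)
open import Relation.Nullary.Negation using (¬_)

-- Throughout, the element k of [n] is the element of Fin n with value k - 1.

private
  variable
    A : Set
    n : ℕ

rotate : List A → List A
rotate []       = []
rotate (x ∷ xs) = xs ∷ʳ x

-- The pairs (c_t , c_{t+1}) for t ∈ [k], where c_{k+1} = c_1.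
cyclicPairs : List A → List (A × A)
cyclicPairs c = zip c (rotate c)

cdes casc : List (Fin n) → ℕ
cdes c = length (filter (λ (a , b) → b <? a) (cyclicPairs c))
casc c = length (filter (λ (a , b) → a <? b) (cyclicPairs c))

cyclicWeight : List (Fin n) → ℕ
cyclicWeight c = cdes c ⊓ casc c

-- The word x, π x, π² x, … stopping just before the first return to x.  A
-- return occurs among π x, …, πⁿ x, so n iterates suffice.
cycleFrom : Permutation′ n → Fin n → List (Fin n)
cycleFrom {n} π x =
  x ∷ takeWhile (λ y → ¬? (y ≟ x)) (iterate (π ⟨$⟩ʳ_) (π ⟨$⟩ʳ x) n)

IsCycleMin : Permutation′ n → Fin n → Set
IsCycleMin π x = All (x ≤_) (cycleFrom π x)

isCycleMin? : (π : Permutation′ n) (x : Fin n) → Dec (IsCycleMin π x)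
isCycleMin? π x = All.all? (x ≤?_) (cycleFrom π x)

-- Every cycle, including fixed points, once, written from its least element.
cycles : Permutation′ n → List (List (Fin n))
cycles {n} π = map (cycleFrom π) (filter (isCycleMin? π) (allFin n))

weight : Permutation′ n → ℕ
weight π = sum (map cyclicWeight (cycles π))

OddOrder : Permutation′ n → Set
OddOrder π = All (λ c → length c % 2 ≡ 1) (cycles π)

oddOrder? : (π : Permutation′ n) → Dec (OddOrder π)
oddOrder? π = All.all? (λ c → length c % 2 ℕ.≟ 1) (cycles π)

𝒫 : (n : ℕ) → ℤ → Permutation′ n → Set
𝒫 n d π = OddOrder π × + weight π ≡ d

𝒫? : (n : ℕ) (d : ℤ) (π : Permutation′ n) → Dec (𝒫 n d π)
𝒫? n d π = oddOrder? π ×-dec (+ weight π ℤ.≟ d)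

-- The cycle of π through b contains a b c consecutively.
HasFactor : Permutation′ n → Fin n → Fin n → Fin n → Set
HasFactor π a b c = π ⟨$⟩ʳ a ≡ b × π ⟨$⟩ʳ b ≡ c

hasFactor? : (π : Permutation′ n) (a b c : Fin n) → Dec (HasFactor π a b c)
hasFactor? π a b c = (π ⟨$⟩ʳ a ≟ b) ×-dec (π ⟨$⟩ʳ b ≟ c)

-- Permutations are compared by the pointwise equality _≈_.  The lemmas
-- permutations-complete and permutations-distinct say that the list contains
-- each permutation exactly once, so filtering it and taking the length counts.
permutations : (n : ℕ) → List (Permutation′ n)
permutations zero    = idₚ ∷ []
permutations (suc n) =
  cartesianProductWith (insert zero) (allFin (suc n)) (permutations n)

permutations-complete : (π : Permutation′ n) → Any (_≈ π) (permutations n)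
permutations-complete {zero}  π = here (λ ())
permutations-complete {suc n} π =
  Any.cartesianProductWith⁺ (insert zero) insert-≈
    (∈-allFin (π ⟨$⟩ʳ zero)) (permutations-complete (remove zero π))
  where
  insert-≈ : ∀ {j ρ} → π ⟨$⟩ʳ zero ≡ j → ρ ≈ remove zero π → insert zero j ρ ≈ π
  insert-≈ refl ρ≈ zero    = refl
  insert-≈ refl ρ≈ (suc k) =
    trans (cong (punchIn (π ⟨$⟩ʳ zero)) (ρ≈ k)) (insert-remove zero π (suc k))

≈-setoid : ℕ → Setoid _ _
≈-setoid n = record
  { Carrier       = Permutation′ n
  ; _≈_           = _≈_
  ; isEquivalence = record
    { refl  = λ _ → refl
    ; sym   = λ p i → sym (p i)
    ; trans = λ p q i → trans (p i) (q i)
    }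
  }

permutations-distinct : (n : ℕ) → AllPairs (λ π ρ → ¬ π ≈ ρ) (permutations n)
permutations-distinct zero    = [] ∷ []
permutations-distinct (suc n) =
  Unique.cartesianProductWith⁺ (setoid (Fin (suc n))) (≈-setoid n) (≈-setoid (suc n))
    (insert zero) (λ {w} {x} {π} {ρ} → insert-injective {w} {x} {π} {ρ})
    (allFin⁺ (suc n)) (permutations-distinct n)
  where
  insert-injective : ∀ {w x : Fin (suc n)} {π ρ : Permutation′ n} →
                     insert zero w π ≈ insert zero x ρ → w ≡ x × π ≈ ρ
  insert-injective {w} p with refl ← p zero =
    refl , λ k → punchIn-injective w _ _ (p (suc k))

-- The matrix P(n,d).  Its index i ∈ [n - 1] is inject₁ i as an element of [n],
-- and the element n of [n] is fromℕ (n - 1).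
P : (n : ℕ) → ℤ → Fin (pred n) → Fin (pred n) → ℕ
P zero    d ()
P (suc m) d i j = length (filter
  (λ π → 𝒫? (suc m) d π ×-dec hasFactor? π (inject₁ i) (fromℕ m) (inject₁ j))
  (permutations (suc m)))

{-# OPTIONS --safe #-}
module Submission where

-- Inversion reverses every cycle, exchanging cdes and casc, and turns the factor i n j
-- into j n i; this is the symmetry.  For the Toeplitz property conjugate by the cycle
-- (1 2 … n-1).  Among 1, …, n it changes the order only of the pairs containing n - 1
-- and a smaller element.  In a cycle containing i n j with i, j < n - 1, the element
-- n - 1 is not adjacent to n, so if it is not a fixed point it is a cyclic peak, and its
-- image 1 is a cyclic valley: one ascent and one descent trade places and both cyclic
-- numbers are preserved.

open import Defs
open import Data.Bool.Base using (true; false; if_then_else_)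
open import Data.Fin.Base using (Fin; zero; suc; toℕ; fromℕ; inject₁; _<_)
open import Data.Fin.Permutation
  using (Permutation′; permutation; _⟨$⟩ʳ_; _⟨$⟩ˡ_; _≈_; _∘ₚ_; flip; inverseˡ; inverseʳ)
  renaming (id to idₚ)
open import Data.Fin.Properties
  using (_≟_; _<?_; ≤-antisym; ≤-totalOrder; injective⇒≤; toℕ-injective;
         inject₁-injective; fromℕ≢inject₁; toℕ-fromℕ; toℕ-inject₁; toℕ<n)
open import Data.Fin.Relation.Unary.Top
  using (View; view; view-unique; ‵fromℕ; ‵inj₁; view-fromℕ; view-inject₁)
open import Data.Integer.Base as ℤ using (ℤ)
open import Data.List.Base
  using (List; []; _∷_; _∷ʳ_; allFin; filter; iterate; length; lookup; map; takeWhile; zip)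
open import Data.List.Extrema using (min; min≤xs; argmin-sel)
open import Data.List.Membership.Propositional using (_∈_; find; lose)
open import Data.List.Membership.Propositional.Properties
  using (∈-allFin; ∈-filter⁺; ∈-filter⁻; ∈-map⁺; ∈-map⁻; ∈-lookup)
open import Data.List.Membership.Propositional.Properties.WithK using (unique∧set⇒bag)
import Data.List.Membership.Setoid as SetoidMembership
open import Data.List.Membership.Setoid.Properties using (index-injective)
open import Data.List.Properties
  using (length-iterate; length-map; length-tabulate; map-∘; map-cong; filter-≐)
open import Data.List.Relation.Binary.BagAndSetEquality using (∼bag⇒↭)
open import Data.List.Relation.Binary.Permutation.Propositional using (_↭_; ↭-sym; ↭-trans)
open import Data.List.Relation.Binary.Permutation.Propositional.Properties
  using (All-resp-↭; filter-↭; ↭-length) renaming (map⁺ to ↭-map⁺)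
open import Data.List.Relation.Unary.All as All using (All; []; _∷_)
import Data.List.Relation.Unary.All.Properties as All
open import Data.List.Relation.Unary.AllPairs as AllPairs using ([]; _∷_)
import Data.List.Relation.Unary.AllPairs.Properties as AllPairs
open import Data.List.Relation.Unary.Any as Any using (Any; here; there)
open import Data.List.Relation.Unary.Unique.Propositional using (Unique)
import Data.List.Relation.Unary.Unique.Propositional.Properties as Unique
import Data.List.Relation.Unary.Unique.Setoid as SetoidUnique
open import Data.Nat.Base as ℕ using (ℕ; zero; suc; pred; _+_; _⊓_; _%_; _≤_; z≤n; s≤s)
open import Data.Nat.ListAction using (sum)
import Data.Nat.ListAction.Properties as ℕ
import Data.Nat.Properties as ℕ
open import Algebra.Properties.CommutativeSemigroup ℕ.+-commutativeSemigroup using (interchange)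
open import Data.Product.Base using (_×_; _,_; proj₂; ∃-syntax)
open import Data.Sum.Base using (inj₁; inj₂)
open import Function.Base using (_∘_; id)
open import Function.Bundles using (mk⇔)
open import Relation.Binary.Bundles using (Setoid)
open import Relation.Binary.Construct.Closure.ReflexiveTransitive as Star using (Star; ε; _◅_; _◅◅_)
open import Relation.Binary.PropositionalEquality
  using (_≡_; _≢_; refl; sym; trans; cong; cong₂; subst; subst₂; setoid; module ≡-Reasoning)
open import Relation.Nullary.Decidable using (Dec; yes; no; does; ¬?; _×-dec_)
open import Relation.Nullary.Negation using (¬_; contradiction)
open import Relation.Unary using (Decidable)

private
  variable
    A B : Set
    n : ℕ

-- Lists without repetition

module _ {c ℓ} (S : Setoid c ℓ) where
  open Setoid S using () renaming (_≈_ to _∼_; sym to ∼-sym)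
  open SetoidMembership S using () renaming (_∈_ to _∈ₛ_)
  open SetoidUnique S using () renaming (Unique to Uniqueₛ)

  lookup-injective : ∀ {xs} → Uniqueₛ xs → ∀ {i j} → lookup xs i ∼ lookup xs j → i ≡ j
  lookup-injective (_ ∷ _)  {zero}  {zero}  _ = refl
  lookup-injective (≁s ∷ _) {zero}  {suc j} p = contradiction p (All.lookup ≁s (∈-lookup j))
  lookup-injective (≁s ∷ _) {suc i} {zero}  p = contradiction (∼-sym p) (All.lookup ≁s (∈-lookup i))
  lookup-injective (_ ∷ u)  {suc i} {suc j} p = cong suc (lookup-injective u p)

  -- Pigeonhole on positions. The setoid is left general because the lemma is applied both to
  -- elements of `Fin n` and to permutations under `_≈_`.
  unique-⊆⇒length-≤ : ∀ {xs ys} → Uniqueₛ xs → All (_∈ₛ ys) xs → length xs ≤ length ys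
  unique-⊆⇒length-≤ {xs} u ∈ys = injective⇒≤ λ {i} {j} eq →
    lookup-injective u (index-injective S (image i) (image j) eq)
    where
    image : ∀ i → _
    image i = All.lookup ∈ys (∈-lookup {xs = xs} i)

unique-↭ : {xs ys : List A} → Unique xs → Unique ys →
           (∀ {z} → z ∈ xs → z ∈ ys) → (∀ {z} → z ∈ ys → z ∈ xs) → xs ↭ ys
unique-↭ u v f g = ∼bag⇒↭ (unique∧set⇒bag u v (mk⇔ f g))

∈-insert : ∀ {w x z : A} {xs} → w ∈ x ∷ xs → w ∈ x ∷ z ∷ xs
∈-insert (here eq)  = here eq
∈-insert (there w∈) = there (there w∈)

-- Injectivity is asked on the entries only: sending an element to the least element of its cycle
-- separates cycle minima, but not arbitrary elements.
unique-map-∈ : ∀ {f : A → B} {xs} → (∀ {x y} → x ∈ xs → y ∈ xs → f x ≡ f y → x ≡ y) →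
               Unique xs → Unique (map f xs)
unique-map-∈ inj []       = []
unique-map-∈ inj (x≢ ∷ u) =
  All.map⁺ (All.tabulate λ y∈ eq → All.lookup x≢ y∈ (inj (here refl) (there y∈) eq))
  ∷ unique-map-∈ (λ x∈ y∈ → inj (there x∈) (there y∈)) u

-- Counting by filters

length-filter-map : ∀ {P : B → Set} (P? : Decidable P) (f : A → B) xs →
                    length (filter P? (map f xs)) ≡ length (filter (P? ∘ f) xs)
length-filter-map P? f []       = refl
length-filter-map P? f (x ∷ xs) with does (P? (f x))
... | true  = cong suc (length-filter-map P? f xs)
... | false = length-filter-map P? f xs

length-filter-↭ : ∀ {P : A → Set} (P? : Decidable P) {xs ys} → xs ↭ ys →
                  length (filter P? xs) ≡ length (filter P? ys)
length-filter-↭ P? p = ↭-length (filter-↭ P? p)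

indicator : {P : Set} → Dec P → ℕ
indicator p? = if does p? then 1 else 0

indicator-yes : {P : Set} (p? : Dec P) → P → indicator p? ≡ 1
indicator-yes (yes _) _ = refl
indicator-yes (no ¬p) p = contradiction p ¬p

indicator-no : {P : Set} (p? : Dec P) → ¬ P → indicator p? ≡ 0
indicator-no (yes p) ¬p = contradiction p ¬p
indicator-no (no _)  _  = refl

indicator-cong : {P Q : Set} (p? : Dec P) (q? : Dec Q) → (P → Q) → (Q → P) →
                 indicator p? ≡ indicator q?
indicator-cong (yes p) q? f g = sym (indicator-yes q? (f p))
indicator-cong (no ¬p) q? f g = sym (indicator-no q? (¬p ∘ g))

module _ {P : A → Set} (P? : Decidable P) where

  length-filter-∷ : ∀ x xs →
    length (filter P? (x ∷ xs)) ≡ indicator (P? x) + length (filter P? xs)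
  length-filter-∷ x xs with does (P? x)
  ... | true  = refl
  ... | false = refl

-- Sums a pointwise identity over the list. The second count on each side carries the correction
-- terms of `shift-<`, so that no subtraction occurs.
length-filter-+ :
  ∀ {P Q R T : A → Set}
  (P? : Decidable P) (Q? : Decidable Q) (R? : Decidable R) (T? : Decidable T) xs →
  (∀ x → indicator (P? x) + indicator (Q? x) ≡ indicator (R? x) + indicator (T? x)) →
  length (filter P? xs) + length (filter Q? xs) ≡ length (filter R? xs) + length (filter T? xs)
length-filter-+ P? Q? R? T? []       eq = refl
length-filter-+ P? Q? R? T? (x ∷ xs) eq = begin
  length (filter P? (x ∷ xs)) + length (filter Q? (x ∷ xs))
    ≡⟨ cong₂ _+_ (length-filter-∷ P? x xs) (length-filter-∷ Q? x xs) ⟩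
  (indicator (P? x) + length (filter P? xs)) + (indicator (Q? x) + length (filter Q? xs))
    ≡⟨ interchange (indicator (P? x)) _ _ _ ⟩
  (indicator (P? x) + indicator (Q? x)) + (length (filter P? xs) + length (filter Q? xs))
    ≡⟨ cong₂ _+_ (eq x) (length-filter-+ P? Q? R? T? xs eq) ⟩
  (indicator (R? x) + indicator (T? x)) + (length (filter R? xs) + length (filter T? xs))
    ≡⟨ interchange (indicator (R? x)) _ _ _ ⟩
  (indicator (R? x) + length (filter R? xs)) + (indicator (T? x) + length (filter T? xs))
    ≡⟨ cong₂ _+_ (length-filter-∷ R? x xs) (length-filter-∷ T? x xs) ⟨
  length (filter R? (x ∷ xs)) + length (filter T? (x ∷ xs)) ∎
  where open ≡-Reasoning

-- Iterates of a map

map-iterate : (f : A → A) (x : A) (k : ℕ) → map f (iterate f x k) ≡ iterate f (f x) k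
map-iterate f x zero    = refl
map-iterate f x (suc k) = cong (f x ∷_) (map-iterate f (f x) k)

takeWhile-iterate : ∀ {P : A → Set} (P? : Decidable P) (f : A → A) (z : A) (k : ℕ) →
  ∃[ r ] takeWhile P? (iterate f z k) ≡ iterate f z r
takeWhile-iterate P? f z zero    = 0 , refl
takeWhile-iterate P? f z (suc k) with does (P? z)
... | false = 0 , refl
... | true  = let r , eq = takeWhile-iterate P? f (f z) k in suc r , cong (z ∷_) eq

module _ {f : A → A} (f-injective : ∀ {y z} → f y ≡ f z → y ≡ z) where

  -- The tail is the image under the injective `f` of the word without its last letter, which is
  -- handled by induction; only a return to the head `x` has to be excluded.
  iterate-unique : ∀ x r → All (_≢ x) (iterate f (f x) r) → Unique (iterate f x (suc r))
  iterate-unique x zero    _   = [] ∷ []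
  iterate-unique x (suc r) ≢x =
    All.map (λ y≢x x≡y → y≢x (sym x≡y)) ≢x
    ∷ subst Unique (map-iterate f x (suc r))
        (Unique.map⁺ f-injective (iterate-unique x r (init (f x) r ≢x)))
    where
    init : ∀ {Q : A → Set} z r → All Q (iterate f z (suc r)) → All Q (iterate f z r)
    init z zero    _        = []
    init z (suc r) (q ∷ qs) = q ∷ init (f z) r qs

-- Orbits and the words cycleFrom π x

Step : Permutation′ n → Fin n → Fin n → Set
Step π x y = π ⟨$⟩ʳ x ≡ y

-- Reachability by forward steps only; finiteness makes it symmetric in `orbit-sym`.
Orbit : Permutation′ n → Fin n → Fin n → Set
Orbit π = Star (Step π)

module _ (π : Permutation′ n) where

  ⟨$⟩ʳ-injective : ∀ {x y} → π ⟨$⟩ʳ x ≡ π ⟨$⟩ʳ y → x ≡ y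
  ⟨$⟩ʳ-injective {x} {y} eq = begin
    x                      ≡⟨ inverseˡ π ⟨
    π ⟨$⟩ˡ (π ⟨$⟩ʳ x)      ≡⟨ cong (π ⟨$⟩ˡ_) eq ⟩
    π ⟨$⟩ˡ (π ⟨$⟩ʳ y)      ≡⟨ inverseˡ π ⟩
    y                      ∎
    where open ≡-Reasoning

  cycleFrom-unique : ∀ x → Unique (cycleFrom π x)
  cycleFrom-unique x
    with r , eq ← takeWhile-iterate (λ y → ¬? (y ≟ x)) (π ⟨$⟩ʳ_) (π ⟨$⟩ʳ x) n =
    subst (Unique ∘ (x ∷_)) (sym eq) (iterate-unique ⟨$⟩ʳ-injective x r
      (subst (All (_≢ x)) eq (All.all-takeWhile _ (iterate _ _ n))))

  -- Without a return, the word x, π x, ..., πⁿ x would consist of n + 1 distinct elements of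
  -- `Fin n`.
  return∈iterates : ∀ x → x ∈ iterate (π ⟨$⟩ʳ_) (π ⟨$⟩ʳ x) n
  return∈iterates x with Any.any? (x ≟_) (iterate (π ⟨$⟩ʳ_) (π ⟨$⟩ʳ x) n)
  ... | yes x∈ = x∈
  ... | no  x∉ = contradiction
    (subst (suc n ≤_) (length-tabulate id)
      (subst (λ k → suc k ≤ length (allFin n)) (length-iterate _ _ n)
        (unique-⊆⇒length-≤ (setoid (Fin n))
          (iterate-unique ⟨$⟩ʳ-injective x n
            (All.map (λ x≢y y≡x → x≢y (sym y≡x)) (All.¬Any⇒All¬ _ x∉)))
          (All.tabulate λ {y} _ → ∈-allFin y))))
    (ℕ.<-irrefl refl)

  ∈iterate⇒orbit : ∀ {z y} k → y ∈ iterate (π ⟨$⟩ʳ_) z k → Orbit π z y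
  ∈iterate⇒orbit (suc k) (here refl) = ε
  ∈iterate⇒orbit (suc k) (there y∈)  = refl ◅ ∈iterate⇒orbit k y∈

  -- A step from `x` to its image is undone by following the cycle onwards until it returns to `x`.
  orbit-sym : ∀ {x y} → Orbit π x y → Orbit π y x
  orbit-sym = Star.fold (λ x y → Orbit π y x)
    (λ { {x} refl y→x → y→x ◅◅ ∈iterate⇒orbit n (return∈iterates x) }) ε

  module _ (x : Fin n) where
    private
      -- The tail of `cycleFrom π x` is `path (π ⟨$⟩ʳ x) n`. The start `z` and the number `k` vary
      -- for the inductions below, which assume that `x` still lies ahead.
      path : Fin n → ℕ → List (Fin n)
      path z k = takeWhile (λ y → ¬? (y ≟ x)) (iterate (π ⟨$⟩ʳ_) z k)

    head∈path : ∀ z k → x ∈ iterate (π ⟨$⟩ʳ_) z k → z ∈ x ∷ path z k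
    head∈path z (suc k) x∈ with z ≟ x
    ... | yes z≡x = here z≡x
    ... | no  _   = there (here refl)

    path-closed : ∀ z k → x ∈ iterate (π ⟨$⟩ʳ_) z k → ∀ {y} → y ∈ path z k → π ⟨$⟩ʳ y ∈ x ∷ path z k
    path-closed z (suc k) x∈ y∈ with z ≟ x
    path-closed z (suc k) (here x≡z) _ | no z≢x = contradiction (sym x≡z) z≢x
    path-closed z (suc k) (there x∈) (here refl) | no _ = ∈-insert (head∈path _ k x∈)
    path-closed z (suc k) (there x∈) (there y∈) | no _ = ∈-insert (path-closed _ k x∈ y∈)

    -- Each letter is followed by its image; this includes the last one, followed by `x`, because
    -- `takeWhile` stopped exactly at the return.
    zip-path : ∀ w k → x ∈ iterate (π ⟨$⟩ʳ_) (π ⟨$⟩ʳ w) k →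
      let ys = path (π ⟨$⟩ʳ w) k in
      zip (w ∷ ys) (ys ∷ʳ x) ≡ map (λ y → y , π ⟨$⟩ʳ y) (w ∷ ys)
    zip-path w (suc k) x∈ with π ⟨$⟩ʳ w ≟ x
    zip-path w (suc k) _          | yes eq = cong (λ v → (w , v) ∷ []) (sym eq)
    zip-path w (suc k) (here eq)  | no neq = contradiction (sym eq) neq
    zip-path w (suc k) (there x∈) | no _   = cong (_ ∷_) (zip-path _ k x∈)

  cyclicPairs-cycleFrom : ∀ x →
    cyclicPairs (cycleFrom π x) ≡ map
      (λ y → y , π ⟨$⟩ʳ y) (cycleFrom π x)
  cyclicPairs-cycleFrom x = zip-path x x n (return∈iterates x)

  cycleFrom-closed : ∀ {x y} → y ∈ cycleFrom π x → π ⟨$⟩ʳ y ∈ cycleFrom π x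
  cycleFrom-closed {x} (here refl) = head∈path x _ n (return∈iterates x)
  cycleFrom-closed {x} (there y∈)  = path-closed x _ n (return∈iterates x) y∈

  orbit⇒∈cycleFrom : ∀ {x y} → Orbit π x y → y ∈ cycleFrom π x
  orbit⇒∈cycleFrom {x} = Star.gfoldl id (λ _ z → z ∈ cycleFrom π x)
    (λ { z∈ refl → cycleFrom-closed z∈ }) {i = x} (here refl)

  ∈cycleFrom⇒orbit : ∀ {x y} → y ∈ cycleFrom π x → Orbit π x y
  ∈cycleFrom⇒orbit (here refl) = ε
  ∈cycleFrom⇒orbit {x} (there y∈)
    with r , eq ← takeWhile-iterate (λ y → ¬? (y ≟ x)) (π ⟨$⟩ʳ_) (π ⟨$⟩ʳ x) n
    = refl ◅ ∈iterate⇒orbit r (subst (_ ∈_) eq y∈)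

  cycleFrom-↭ : ∀ {x y} → Orbit π x y → cycleFrom π x ↭ cycleFrom π y
  cycleFrom-↭ x→y = unique-↭ (cycleFrom-unique _) (cycleFrom-unique _)
    (λ z∈ → orbit⇒∈cycleFrom (orbit-sym x→y ◅◅ ∈cycleFrom⇒orbit z∈))
    (λ z∈ → orbit⇒∈cycleFrom (x→y ◅◅ ∈cycleFrom⇒orbit z∈))

  map-cycleFrom-↭ : ∀ x → map (π ⟨$⟩ʳ_) (cycleFrom π x) ↭ cycleFrom π x
  map-cycleFrom-↭ x =
    unique-↭ (Unique.map⁺ ⟨$⟩ʳ-injective (cycleFrom-unique x)) (cycleFrom-unique x) image⊆ ⊆image
    where
    image⊆ : ∀ {z} → z ∈ map (π ⟨$⟩ʳ_) (cycleFrom π x) → z ∈ cycleFrom π x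
    image⊆ z∈ with y , y∈ , refl ← ∈-map⁻ (π ⟨$⟩ʳ_) z∈ = cycleFrom-closed y∈

    ⊆image : ∀ {z} → z ∈ cycleFrom π x → z ∈ map (π ⟨$⟩ʳ_) (cycleFrom π x)
    ⊆image {z} z∈ = subst (_∈ map (π ⟨$⟩ʳ_) (cycleFrom π x)) (inverseʳ π)
      (∈-map⁺ (π ⟨$⟩ʳ_)
        (orbit⇒∈cycleFrom (∈cycleFrom⇒orbit z∈ ◅◅ orbit-sym (inverseʳ π ◅ ε))))

  -- Descents and ascents of a cycle

  descent? : Decidable (λ y → π ⟨$⟩ʳ y < y)
  descent? y = π ⟨$⟩ʳ y <? y

  ascent? : Decidable (λ y → y < π ⟨$⟩ʳ y)
  ascent? y = y <? π ⟨$⟩ʳ y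

  -- The right-hand side counts single letters, so it depends neither on their order nor on the
  -- starting point of the cycle.
  cdes-cycleFrom : ∀ x → cdes (cycleFrom π x) ≡ length (filter descent? (cycleFrom π x))
  cdes-cycleFrom x rewrite cyclicPairs-cycleFrom x =
    length-filter-map {P = λ (a , b) → b < a} (λ (a , b) → b <? a)
      (λ y → y , π ⟨$⟩ʳ y) (cycleFrom π x)

  casc-cycleFrom : ∀ x → casc (cycleFrom π x) ≡ length (filter ascent? (cycleFrom π x))
  casc-cycleFrom x rewrite cyclicPairs-cycleFrom x =
    length-filter-map {P = λ (a , b) → a < b} (λ (a , b) → a <? b)
      (λ y → y , π ⟨$⟩ʳ y) (cycleFrom π x)

  cyclicWeight-orbit : ∀ {x y} → Orbit π x y →
                       cyclicWeight (cycleFrom π x) ≡ cyclicWeight (cycleFrom π y)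
  cyclicWeight-orbit {x} {y} x→y = cong₂ _⊓_
    (trans (cdes-cycleFrom x)
      (trans (length-filter-↭ descent? (cycleFrom-↭ x→y)) (sym (cdes-cycleFrom y))))
    (trans (casc-cycleFrom x)
      (trans (length-filter-↭ ascent? (cycleFrom-↭ x→y)) (sym (casc-cycleFrom y))))

  -- Least elements of cycles

  cycleMinima : List (Fin n)
  cycleMinima = filter (isCycleMin? π) (allFin n)

  abstract
    -- The default value `x` of `min` is itself a letter of the word, so the result always lies on
    -- the cycle.
    cycleMin : Fin n → Fin n
    cycleMin x = min (≤-totalOrder n) x (cycleFrom π x)

    orbit-cycleMin : ∀ x → Orbit π x (cycleMin x)
    orbit-cycleMin x with argmin-sel (≤-totalOrder n) id x (cycleFrom π x)
    ... | inj₁ eq  = subst (Orbit π x) (sym eq) ε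
    ... | inj₂ min∈ = ∈cycleFrom⇒orbit min∈

    cycleMin-isCycleMin : ∀ x → IsCycleMin π (cycleMin x)
    cycleMin-isCycleMin x =
      All-resp-↭ (cycleFrom-↭ (orbit-cycleMin x)) (min≤xs (≤-totalOrder n) x (cycleFrom π x))

  isCycleMin-unique : ∀ {x y} → IsCycleMin π x → IsCycleMin π y → Orbit π x y → x ≡ y
  isCycleMin-unique x-min y-min x→y = ≤-antisym
    (All.lookup x-min (orbit⇒∈cycleFrom x→y))
    (All.lookup y-min (orbit⇒∈cycleFrom (orbit-sym x→y)))

  cycleMinima⁻ : ∀ {x} → x ∈ cycleMinima → IsCycleMin π x
  cycleMinima⁻ x∈ = proj₂ (∈-filter⁻ (isCycleMin? π) {xs = allFin n} x∈)

-- Comparing the cycles of two permutations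

-- The hypotheses say that `τ` carries the cycles of `π` onto those of `ρ` as sets, whatever their
-- cyclic order. Inversion takes the identity for `τ`, conjugation takes `shiftₚ`.
module _ {π ρ : Permutation′ n} (τ : Permutation′ n)
  (orbit⁺ : ∀ {x y} → Orbit π x y → Orbit ρ (τ ⟨$⟩ʳ x) (τ ⟨$⟩ʳ y))
  (orbit⁻ : ∀ {x y} → Orbit ρ (τ ⟨$⟩ʳ x) (τ ⟨$⟩ʳ y) → Orbit π x y)
  where

  cycleFrom-relabel : ∀ x → cycleFrom ρ (τ ⟨$⟩ʳ x) ↭ map (τ ⟨$⟩ʳ_) (cycleFrom π x)
  cycleFrom-relabel x =
    unique-↭ (cycleFrom-unique ρ _) (Unique.map⁺ (⟨$⟩ʳ-injective τ) (cycleFrom-unique π x)) to from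
    where
    to : ∀ {z} → z ∈ cycleFrom ρ (τ ⟨$⟩ʳ x) → z ∈ map (τ ⟨$⟩ʳ_) (cycleFrom π x)
    to z∈ = subst (_∈ map (τ ⟨$⟩ʳ_) (cycleFrom π x)) (inverseʳ τ)
      (∈-map⁺ (τ ⟨$⟩ʳ_) (orbit⇒∈cycleFrom π (orbit⁻
        (subst (Orbit ρ _) (sym (inverseʳ τ)) (∈cycleFrom⇒orbit ρ z∈)))))

    from : ∀ {z} → z ∈ map (τ ⟨$⟩ʳ_) (cycleFrom π x) → z ∈ cycleFrom ρ (τ ⟨$⟩ʳ x)
    from z∈ with y , y∈ , refl ← ∈-map⁻ (τ ⟨$⟩ʳ_) z∈ =
      orbit⇒∈cycleFrom ρ (orbit⁺ (∈cycleFrom⇒orbit π y∈))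

  -- As `τ` need not preserve the order, the image of a least element need not be least; it is
  -- replaced by the least element of its `ρ`-cycle. Two minima with the same result lie on one
  -- `π`-cycle and hence agree.
  cycleMinima-relabel : map (λ x → cycleMin ρ (τ ⟨$⟩ʳ x)) (cycleMinima π) ↭ cycleMinima ρ
  cycleMinima-relabel = unique-↭
    (unique-map-∈ injective (Unique.filter⁺ (isCycleMin? π) (Unique.allFin⁺ n)))
    (Unique.filter⁺ (isCycleMin? ρ) (Unique.allFin⁺ n)) to from
    where
    m : Fin n → Fin n
    m x = cycleMin ρ (τ ⟨$⟩ʳ x)

    injective : ∀ {x y} → x ∈ cycleMinima π → y ∈ cycleMinima π → m x ≡ m y → x ≡ y
    injective {x} {y} x∈ y∈ eq = isCycleMin-unique π (cycleMinima⁻ π x∈) (cycleMinima⁻ π y∈)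
      (orbit⁻ (subst (Orbit ρ _) eq (orbit-cycleMin ρ _) ◅◅ orbit-sym ρ (orbit-cycleMin ρ _)))

    to : ∀ {z} → z ∈ map m (cycleMinima π) → z ∈ cycleMinima ρ
    to z∈ with x , _ , refl ← ∈-map⁻ m z∈ =
      ∈-filter⁺ (isCycleMin? ρ) (∈-allFin _) (cycleMin-isCycleMin ρ _)

    from : ∀ {z} → z ∈ cycleMinima ρ → z ∈ map m (cycleMinima π)
    from {z} z∈ = subst (_∈ map m (cycleMinima π)) m-x≡z
      (∈-map⁺ m (∈-filter⁺ (isCycleMin? π) (∈-allFin x) (cycleMin-isCycleMin π _)))
      where
      x : Fin n
      x = cycleMin π (τ ⟨$⟩ˡ z)

      m-x≡z : m x ≡ z
      m-x≡z = isCycleMin-unique ρ (cycleMin-isCycleMin ρ _) (cycleMinima⁻ ρ z∈)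
        (orbit-sym ρ (subst (λ w → Orbit ρ w (m x)) (inverseʳ τ)
          (orbit⁺ (orbit-cycleMin π _) ◅◅ orbit-cycleMin ρ _)))

  -- Since `g` is constant on the cycles of `ρ`, it may be evaluated at the image of a minimum
  -- instead of at the minimum of the image cycle.
  map-cycleMinima-↭ : {f g : Fin n → ℕ} →
    (∀ {x y} → Orbit ρ x y → g x ≡ g y) → (∀ x → f x ≡ g (τ ⟨$⟩ʳ x)) →
    map f (cycleMinima π) ↭ map g (cycleMinima ρ)
  map-cycleMinima-↭ {f} {g} g-orbit f≡g∘τ = subst (_↭ map g (cycleMinima ρ))
    (trans (sym (map-∘ (cycleMinima π)))
      (map-cong (λ x → sym (trans (f≡g∘τ x) (g-orbit (orbit-cycleMin ρ _)))) (cycleMinima π)))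
    (↭-map⁺ g cycleMinima-relabel)

  module _ (weight-relabel : ∀ x →
             cyclicWeight (cycleFrom π x) ≡ cyclicWeight (cycleFrom ρ (τ ⟨$⟩ʳ x)))
    where

    lengths-↭ : map (length ∘ cycleFrom π) (cycleMinima π) ↭
                map (length ∘ cycleFrom ρ) (cycleMinima ρ)
    lengths-↭ = map-cycleMinima-↭ (↭-length ∘ cycleFrom-↭ ρ)
      (λ x → sym (trans (↭-length (cycleFrom-relabel x)) (length-map _ (cycleFrom π x))))

    weight≡ : weight π ≡ weight ρ
    weight≡ = begin
      weight π
        ≡⟨ cong sum (map-∘ (cycleMinima π)) ⟨
      sum (map (cyclicWeight ∘ cycleFrom π) (cycleMinima π))
        ≡⟨ ℕ.sum-↭ (map-cycleMinima-↭ (cyclicWeight-orbit ρ) weight-relabel) ⟩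
      sum (map (cyclicWeight ∘ cycleFrom ρ) (cycleMinima ρ))
        ≡⟨ cong sum (map-∘ (cycleMinima ρ)) ⟩
      weight ρ
        ∎
      where open ≡-Reasoning

    private
      Odd : ℕ → Set
      Odd k = k % 2 ≡ 1

    𝒫⁺ : ∀ {d} → 𝒫 n d π → 𝒫 n d ρ
    𝒫⁺ (odd , w≡d) =
      -- Odd order depends only on the list of cycle lengths, which `π` and `ρ` share up to order.
      All.map⁺ (All.map⁻ (All-resp-↭ {P = Odd} lengths-↭ (All.map⁺ (All.map⁻ odd)))) ,
      trans (cong ℤ.+_ (sym weight≡)) w≡d

    𝒫⁻ : ∀ {d} → 𝒫 n d ρ → 𝒫 n d π
    𝒫⁻ (odd , w≡d) =
      All.map⁺ (All.map⁻ (All-resp-↭ {P = Odd} (↭-sym lengths-↭) (All.map⁺ (All.map⁻ odd)))) ,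
      trans (cong ℤ.+_ weight≡) w≡d

-- Inversion

module _ {π ρ : Permutation′ n} (ρ∘π≗id : ∀ x → ρ ⟨$⟩ʳ (π ⟨$⟩ʳ x) ≡ x) where

  private
    π∘ρ≗id : ∀ x → π ⟨$⟩ʳ (ρ ⟨$⟩ʳ x) ≡ x
    π∘ρ≗id x = ⟨$⟩ʳ-injective ρ (ρ∘π≗id (ρ ⟨$⟩ʳ x))

  orbit-inverse⁺ : ∀ {x y} → Orbit π x y → Orbit ρ x y
  orbit-inverse⁺ = orbit-sym ρ ∘ Star.reverse λ { {x} refl → ρ∘π≗id x }

  orbit-inverse⁻ : ∀ {x y} → Orbit ρ x y → Orbit π x y
  orbit-inverse⁻ = orbit-sym π ∘ Star.reverse λ { {x} refl → π∘ρ≗id x }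

  -- Writing the letters of the cycle of `ρ` as images under `π` lets a descent of `ρ` at the image
  -- of `y` be matched with an ascent of `π` at `y`.
  cycleFrom-inverse : ∀ x → cycleFrom ρ x ↭ map (π ⟨$⟩ʳ_) (cycleFrom π x)
  cycleFrom-inverse x = ↭-trans
    (unique-↭ (cycleFrom-unique ρ x) (cycleFrom-unique π x)
      (λ z∈ → orbit⇒∈cycleFrom π (orbit-inverse⁻ (∈cycleFrom⇒orbit ρ z∈)))
      (λ z∈ → orbit⇒∈cycleFrom ρ (orbit-inverse⁺ (∈cycleFrom⇒orbit π z∈))))
    (↭-sym (map-cycleFrom-↭ π x))

  cdes-inverse : ∀ x → cdes (cycleFrom ρ x) ≡ casc (cycleFrom π x)
  cdes-inverse x = begin
    cdes (cycleFrom ρ x)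
      ≡⟨ cdes-cycleFrom ρ x ⟩
    length (filter (descent? ρ) (cycleFrom ρ x))
      ≡⟨ length-filter-↭ (descent? ρ) (cycleFrom-inverse x) ⟩
    length (filter (descent? ρ) (map (π ⟨$⟩ʳ_) (cycleFrom π x)))
      ≡⟨ length-filter-map (descent? ρ) (π ⟨$⟩ʳ_) (cycleFrom π x) ⟩
    length (filter (descent? ρ ∘ (π ⟨$⟩ʳ_)) (cycleFrom π x))
      ≡⟨ cong length (filter-≐ (descent? ρ ∘ (π ⟨$⟩ʳ_)) (ascent? π)
           ( (λ {y} → subst (_< π ⟨$⟩ʳ y) (ρ∘π≗id y))
           , (λ {y} → subst (_< π ⟨$⟩ʳ y) (sym (ρ∘π≗id y)))) (cycleFrom π x)) ⟩
    length (filter (ascent? π) (cycleFrom π x))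
      ≡⟨ casc-cycleFrom π x ⟨
    casc (cycleFrom π x) ∎
    where open ≡-Reasoning

-- The orbits are the same, and the minimum of `cdes` and `casc` survives their exchange. `ρ` is any
-- pointwise inverse rather than `flip π`, since the list of permutations represents `flip π` only
-- up to `_≈_`.
𝒫-inverse : ∀ {d} {π ρ : Permutation′ n} →
            (∀ x → ρ ⟨$⟩ʳ (π ⟨$⟩ʳ x) ≡ x) → 𝒫 n d π → 𝒫 n d ρ
𝒫-inverse {π = π} {ρ} ρ∘π≗id = 𝒫⁺ {π = π} {ρ} idₚ
  (orbit-inverse⁺ {π = π} {ρ} ρ∘π≗id) (orbit-inverse⁻ {π = π} {ρ} ρ∘π≗id)
  λ x → trans (ℕ.⊓-comm (cdes (cycleFrom π x)) (casc (cycleFrom π x)))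
    (cong₂ _⊓_ (sym (cdes-inverse {π = π} {ρ} ρ∘π≗id x))
      (cdes-inverse {π = ρ} {π} (λ y → ⟨$⟩ʳ-injective ρ (ρ∘π≗id (ρ ⟨$⟩ʳ y))) x))

-- Conjugation by the cycle (1 2 … n-1)

module _ {k : ℕ} where

  -- As elements of [n] with n = k + 2, max is n and last is n - 1, and shift is the
  -- cycle (1 2 … n-1).
  max last : Fin (suc (suc k))
  max  = fromℕ (suc k)
  last = inject₁ (fromℕ k)

  shiftView : {x : Fin (suc (suc k))} → View x → Fin (suc (suc k))
  shiftView ‵fromℕ                   = max
  shiftView (‵inj₁ ‵fromℕ)           = zero
  shiftView (‵inj₁ (‵inj₁ {i = i} _)) = suc (inject₁ i)

  shift : Fin (suc (suc k)) → Fin (suc (suc k))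
  shift x = shiftView (view x)

  -- Views are unique, so `shift` can be computed from whichever view is at hand.
  shift-view : ∀ {x} (v : View x) → shift x ≡ shiftView v
  shift-view v = cong shiftView (view-unique v)

  unshiftView : {y : Fin (suc k)} → View y → Fin (suc (suc k))
  unshiftView ‵fromℕ            = max
  unshiftView (‵inj₁ {i = i} _) = inject₁ (inject₁ i)

  unshift : Fin (suc (suc k)) → Fin (suc (suc k))
  unshift zero    = last
  unshift (suc y) = unshiftView (view y)

  shift-unshift : ∀ y → shift (unshift y) ≡ y
  shift-unshift zero    = shift-view (‵inj₁ ‵fromℕ)
  shift-unshift (suc y) with view y
  ... | ‵fromℕ           = shift-view ‵fromℕ
  ... | ‵inj₁ {i = i} v = shift-view (‵inj₁ (‵inj₁ v))

  unshift-shift : ∀ x → unshift (shift x) ≡ x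
  unshift-shift x with view x
  ... | ‵fromℕ                    = cong unshiftView (view-fromℕ k)
  ... | ‵inj₁ ‵fromℕ              = refl
  ... | ‵inj₁ (‵inj₁ {i = i} v)  = cong unshiftView (view-inject₁ i)

  shiftₚ : Permutation′ (suc (suc k))
  shiftₚ = permutation shift unshift shift-unshift unshift-shift

  max≢inject₁ : {i : Fin (suc k)} → max ≢ inject₁ i
  max≢inject₁ = fromℕ≢inject₁

  last≢inject₁² : {i : Fin k} → last ≢ inject₁ (inject₁ i)
  last≢inject₁² = fromℕ≢inject₁ ∘ inject₁-injective

  inject₁<max : (i : Fin (suc k)) → inject₁ i < max
  inject₁<max i rewrite toℕ-inject₁ i | toℕ-fromℕ (suc k) = toℕ<n i

  inject₁²<last : (i : Fin k) → inject₁ (inject₁ i) < last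
  inject₁²<last i
    rewrite toℕ-inject₁ (fromℕ k) | toℕ-fromℕ k | toℕ-inject₁ (inject₁ i) | toℕ-inject₁ i
    = toℕ<n i

  -- Unless {u , v} = {last , max}, shift changes the order of u and v exactly when
  -- one of them is last; the equality tests make up for this, and summed over the
  -- pairs (y , π y) of a cycle they cancel.
  shift-< : ∀ u v → ¬ (u ≡ last × v ≡ max) → ¬ (u ≡ max × v ≡ last) →
    indicator (u <? v) + indicator (u ≟ last) ≡
    indicator (shift u <? shift v) + indicator (v ≟ last)
  shift-< u v ¬lm ¬ml with view u | view v
  ... | ‵fromℕ | ‵fromℕ = refl
  ... | ‵fromℕ | ‵inj₁ ‵fromℕ = contradiction (refl , refl) ¬ml
  ... | ‵fromℕ | ‵inj₁ (‵inj₁ {i = j} _) = cong₂ _+_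
    (trans (indicator-no (max <? inject₁ (inject₁ j)) (ℕ.<-asym (inject₁<max _)))
      (sym (indicator-no (max <? suc (inject₁ j)) (ℕ.<-asym (inject₁<max (suc j))))))
    (trans (indicator-no (max ≟ last) max≢inject₁)
      (sym (indicator-no (inject₁ (inject₁ j) ≟ last) (last≢inject₁² ∘ sym))))
  ... | ‵inj₁ ‵fromℕ | ‵fromℕ = contradiction (refl , refl) ¬lm
  ... | ‵inj₁ ‵fromℕ | ‵inj₁ ‵fromℕ = cong (_+ indicator (last ≟ last))
    (indicator-no (last <? last) (ℕ.<-irrefl refl))
  -- Here `shift u` is `zero`, so the right-hand inequality evaluates to true while the left-hand
  -- one is false; the test `u ≟ last` makes up the difference.
  ... | ‵inj₁ ‵fromℕ | ‵inj₁ (‵inj₁ {i = j} _) = trans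
    (cong₂ _+_ (indicator-no (last <? inject₁ (inject₁ j)) (ℕ.<-asym (inject₁²<last j)))
      (indicator-yes (last ≟ last) refl))
    (cong suc (sym (indicator-no (inject₁ (inject₁ j) ≟ last) (last≢inject₁² ∘ sym))))
  ... | ‵inj₁ (‵inj₁ {i = i} _) | ‵fromℕ = cong₂ _+_
    (trans (indicator-yes (inject₁ (inject₁ i) <? max) (inject₁<max (inject₁ i)))
      (sym (indicator-yes (suc (inject₁ i) <? max) (inject₁<max (suc i)))))
    (trans (indicator-no (inject₁ (inject₁ i) ≟ last) (last≢inject₁² ∘ sym))
      (sym (indicator-no (max ≟ last) max≢inject₁)))
  ... | ‵inj₁ (‵inj₁ {i = i} _) | ‵inj₁ ‵fromℕ = trans
    (cong₂ _+_ (indicator-yes (inject₁ (inject₁ i) <? last) (inject₁²<last i))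
      (indicator-no (inject₁ (inject₁ i) ≟ last) (last≢inject₁² ∘ sym)))
    (sym (indicator-yes (last ≟ last) refl))
  ... | ‵inj₁ (‵inj₁ {i = i} _) | ‵inj₁ (‵inj₁ {i = j} _) = cong₂ _+_
    (indicator-cong
      (inject₁ (inject₁ i) <? inject₁ (inject₁ j)) (suc (inject₁ i) <? suc (inject₁ j))
      (λ p → s≤s (subst₂ ℕ._<_ (toℕ-inject₁ (inject₁ i)) (toℕ-inject₁ (inject₁ j)) p))
      (λ { (s≤s p) →
        subst₂ ℕ._<_ (sym (toℕ-inject₁ (inject₁ i))) (sym (toℕ-inject₁ (inject₁ j))) p }))
    (trans (indicator-no (inject₁ (inject₁ i) ≟ last) (last≢inject₁² ∘ sym))
      (sym (indicator-no (inject₁ (inject₁ j) ≟ last) (last≢inject₁² ∘ sym))))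

  shift-max : shift max ≡ max
  shift-max = shift-view ‵fromℕ

  -- The existence of `i⁺` rules out the element n - 1, the only one at which `shift` wraps around.
  shift-inject₁ : ∀ {i i⁺} → toℕ i⁺ ≡ suc (toℕ i) → shift (inject₁ i) ≡ inject₁ i⁺
  shift-inject₁ {i} {i⁺} eq with view i
  ... | ‵fromℕ = contradiction (toℕ<n i⁺) (ℕ.<-irrefl (trans eq (cong suc (toℕ-fromℕ k))))
  ... | ‵inj₁ {i = h} v = trans (shift-view (‵inj₁ (‵inj₁ v)))
    (cong inject₁ (toℕ-injective (sym (trans eq (cong suc (toℕ-inject₁ h))))))

  module _ {π ρ : Permutation′ (suc (suc k))}
    (ρ∘shift≗shift∘π : ∀ x → ρ ⟨$⟩ʳ shift x ≡ shift (π ⟨$⟩ʳ x))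
    (π-max≢last : π ⟨$⟩ʳ max ≢ last) (π-last≢max : π ⟨$⟩ʳ last ≢ max)
    where

    orbit-shift⁺ : ∀ {x y} → Orbit π x y → Orbit ρ (shift x) (shift y)
    orbit-shift⁺ = Star.gmap shift λ { {x} refl → ρ∘shift≗shift∘π x }

    orbit-unshift : ∀ {x y} → Orbit ρ x y → Orbit π (unshift x) (unshift y)
    orbit-unshift = Star.gmap unshift λ { {x} refl → ⟨$⟩ʳ-injective shiftₚ (begin
      shift (π ⟨$⟩ʳ unshift x)    ≡⟨ ρ∘shift≗shift∘π (unshift x) ⟨
      ρ ⟨$⟩ʳ shift (unshift x)    ≡⟨ cong (ρ ⟨$⟩ʳ_) (shift-unshift x) ⟩
      ρ ⟨$⟩ʳ x                    ≡⟨ shift-unshift (ρ ⟨$⟩ʳ x) ⟨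
      shift (unshift (ρ ⟨$⟩ʳ x))  ∎) }
      where open ≡-Reasoning

    orbit-shift⁻ : ∀ {x y} → Orbit ρ (shift x) (shift y) → Orbit π x y
    orbit-shift⁻ {x} {y} p = subst₂ (Orbit π) (unshift-shift x) (unshift-shift y) (orbit-unshift p)

    private
      image≟last : Decidable (λ y → π ⟨$⟩ʳ y ≡ last)
      image≟last y = π ⟨$⟩ʳ y ≟ last

      -- `π` permutes the letters of its cycle, so `last` is as often an image as a letter. This is
      -- what cancels the corrections of `shift-<`.
      count-last : ∀ x → length (filter image≟last (cycleFrom π x)) ≡
                         length (filter (_≟ last) (cycleFrom π x))
      count-last x = trans (sym (length-filter-map (_≟ last) (π ⟨$⟩ʳ_) (cycleFrom π x)))
        (length-filter-↭ (_≟ last) (map-cycleFrom-↭ π x))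

      cycleFrom-shift : ∀ x → cycleFrom ρ (shift x) ↭ map shift (cycleFrom π x)
      cycleFrom-shift = cycleFrom-relabel {π = π} {ρ} shiftₚ orbit-shift⁺ orbit-shift⁻

    shiftedDescent? : Decidable (λ y → shift (π ⟨$⟩ʳ y) < shift y)
    shiftedDescent? y = shift (π ⟨$⟩ʳ y) <? shift y

    shiftedAscent? : Decidable (λ y → shift y < shift (π ⟨$⟩ʳ y))
    shiftedAscent? y = shift y <? shift (π ⟨$⟩ʳ y)

    cdes-shift : ∀ x → cdes (cycleFrom π x) ≡ cdes (cycleFrom ρ (shift x))
    cdes-shift x = begin
      cdes (cycleFrom π x)
        ≡⟨ cdes-cycleFrom π x ⟩
      length (filter (descent? π) (cycleFrom π x))
        -- Both sides are enlarged by the number of occurrences of `last`, and `shift-<` is summed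
        -- over the cycle.
        ≡⟨ ℕ.+-cancelʳ-≡ _ _ _ (trans (cong (length (filter (descent? π) (cycleFrom π x)) +_) (sym (count-last x)))
             (length-filter-+ (descent? π) image≟last shiftedDescent? (_≟ last)
               (cycleFrom π x) λ y → shift-< (π ⟨$⟩ʳ y) y
                 -- The two pairs excluded by `shift-<` would be steps of `π` between n and n - 1.
                 (λ { (p , refl) → π-max≢last p }) (λ { (p , refl) → π-last≢max p }))) ⟩
      length (filter shiftedDescent? (cycleFrom π x))
        ≡⟨ cong length (filter-≐ shiftedDescent? (descent? ρ ∘ shift)
             ( (λ {y} → subst (_< shift y) (sym (ρ∘shift≗shift∘π y)))
             , (λ {y} → subst (_< shift y) (ρ∘shift≗shift∘π y))) (cycleFrom π x)) ⟩
      length (filter (descent? ρ ∘ shift) (cycleFrom π x))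
        ≡⟨ length-filter-map (descent? ρ) shift (cycleFrom π x) ⟨
      length (filter (descent? ρ) (map shift (cycleFrom π x)))
        ≡⟨ length-filter-↭ (descent? ρ) (cycleFrom-shift x) ⟨
      length (filter (descent? ρ) (cycleFrom ρ (shift x)))
        ≡⟨ cdes-cycleFrom ρ (shift x) ⟨
      cdes (cycleFrom ρ (shift x)) ∎
      where open ≡-Reasoning

    -- As for descents, with the arguments of `shift-<` exchanged, so that the two corrections
    -- change sides.
    casc-shift : ∀ x → casc (cycleFrom π x) ≡ casc (cycleFrom ρ (shift x))
    casc-shift x = begin
      casc (cycleFrom π x)
        ≡⟨ casc-cycleFrom π x ⟩
      length (filter (ascent? π) (cycleFrom π x))
        ≡⟨ ℕ.+-cancelʳ-≡ _ _ _ (trans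
             (length-filter-+ (ascent? π) (_≟ last) shiftedAscent? image≟last
               (cycleFrom π x) λ y → shift-< y (π ⟨$⟩ʳ y)
                 (λ { (refl , p) → π-last≢max p }) (λ { (refl , p) → π-max≢last p }))
             (cong (length (filter shiftedAscent? (cycleFrom π x)) +_) (count-last x))) ⟩
      length (filter shiftedAscent? (cycleFrom π x))
        ≡⟨ cong length (filter-≐ shiftedAscent? (ascent? ρ ∘ shift)
             ( (λ {y} → subst (shift y <_) (sym (ρ∘shift≗shift∘π y)))
             , (λ {y} → subst (shift y <_) (ρ∘shift≗shift∘π y))) (cycleFrom π x)) ⟩
      length (filter (ascent? ρ ∘ shift) (cycleFrom π x))
        ≡⟨ length-filter-map (ascent? ρ) shift (cycleFrom π x) ⟨
      length (filter (ascent? ρ) (map shift (cycleFrom π x)))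
        ≡⟨ length-filter-↭ (ascent? ρ) (cycleFrom-shift x) ⟨
      length (filter (ascent? ρ) (cycleFrom ρ (shift x)))
        ≡⟨ casc-cycleFrom ρ (shift x) ⟨
      casc (cycleFrom ρ (shift x)) ∎
      where open ≡-Reasoning

    private
      weight-shift : ∀ x → cyclicWeight (cycleFrom π x) ≡ cyclicWeight (cycleFrom ρ (shift x))
      weight-shift x = cong₂ _⊓_ (cdes-shift x) (casc-shift x)

    𝒫-shift⁺ : ∀ {d} → 𝒫 _ d π → 𝒫 _ d ρ
    𝒫-shift⁺ = 𝒫⁺ {π = π} {ρ} shiftₚ orbit-shift⁺ orbit-shift⁻ weight-shift

    -- Not an instance of `𝒫-shift⁺` with `π` and `ρ` exchanged, as the conditions on n - 1 and n
    -- concern `π` alone.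
    𝒫-shift⁻ : ∀ {d} → 𝒫 _ d ρ → 𝒫 _ d π
    𝒫-shift⁻ = 𝒫⁻ {π = π} {ρ} shiftₚ orbit-shift⁺ orbit-shift⁻ weight-shift

-- Counting

-- Pigeonhole up to `_≈_`. The listed permutation that represents `φ π` is only pointwise equal to
-- it, so `Q` is required of every `ρ ≈ φ π`.
permutations-count-≤ :
  ∀ {P Q : Permutation′ n → Set} (P? : Decidable P) (Q? : Decidable Q)
  (φ : Permutation′ n → Permutation′ n) →
  (∀ {π ρ} → φ π ≈ φ ρ → π ≈ ρ) →
  (∀ {π ρ} → ρ ≈ φ π → P π → Q ρ) →
  length (filter P? (permutations n)) ≤ length (filter Q? (permutations n))
permutations-count-≤ {n} {P} P? Q? φ φ-injective P⇒Q =
  subst (_≤ _) (length-map φ (filter P? (permutations n)))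
    (unique-⊆⇒length-≤ (≈-setoid n)
      (AllPairs.map⁺ (AllPairs.map (λ {π} {ρ} π≉ρ φπ≈φρ → π≉ρ (φ-injective {π} {ρ} φπ≈φρ))
        (AllPairs.filter⁺ P? (permutations-distinct n))))
      (All.map⁺ (All.map image (All.all-filter P? (permutations n)))))
  where
  image : ∀ {π} → P π → Any (φ π ≈_) (filter Q? (permutations n))
  image {π} p with ρ , ρ∈ , ρ≈φπ ← find (permutations-complete (φ π)) =
    lose (∈-filter⁺ Q? ρ∈ (P⇒Q {π} {ρ} ρ≈φπ p)) (sym ∘ ρ≈φπ)

-- Matrix entries and their symmetry

module _ {m : ℕ} (d : ℤ) (i j : Fin m) where

  InP : Permutation′ (suc m) → Set
  InP π = 𝒫 (suc m) d π × HasFactor π (inject₁ i) (fromℕ m) (inject₁ j)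

  inP? : Decidable InP
  inP? π = 𝒫? (suc m) d π ×-dec hasFactor? π (inject₁ i) (fromℕ m) (inject₁ j)

-- Inversion injects one set of permutations into the other; exchanging `i` and `j` gives the
-- opposite inequality.
P-transpose-≤ : ∀ n d (i j : Fin (pred n)) → P n d i j ≤ P n d j i
P-transpose-≤ (suc m) d i j = permutations-count-≤ (inP? d i j) (inP? d j i) flip
  (λ {π} {ρ} eq x → ⟨$⟩ʳ-injective (flip π) (begin
    π ⟨$⟩ˡ (π ⟨$⟩ʳ x)  ≡⟨ inverseˡ π ⟩
    x                  ≡⟨ inverseˡ ρ ⟨
    ρ ⟨$⟩ˡ (ρ ⟨$⟩ʳ x)  ≡⟨ eq (ρ ⟨$⟩ʳ x) ⟨
    π ⟨$⟩ˡ (ρ ⟨$⟩ʳ x)  ∎))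
  λ {π} {ρ} ρ≈π⁻¹ → λ { (p , πi≡max , πmax≡j) →
    let ρ∘π≗id = λ x → trans (ρ≈π⁻¹ (π ⟨$⟩ʳ x)) (inverseˡ π) in
    𝒫-inverse {π = π} {ρ} ρ∘π≗id p
    , trans (cong (ρ ⟨$⟩ʳ_) (sym πmax≡j)) (ρ∘π≗id _)
    , trans (cong (ρ ⟨$⟩ʳ_) (sym πi≡max)) (ρ∘π≗id _) }
  where open ≡-Reasoning

-- The Toeplitz property

module _ {k : ℕ} where

  -- Having successors among the indices, `i` and `j` differ from n - 1, and they are the two
  -- neighbours of n in its cycle.
  factor-avoids-last : ∀ {π : Permutation′ (suc (suc k))} {i j i⁺ j⁺ : Fin (suc k)} →
    toℕ i⁺ ≡ suc (toℕ i) → toℕ j⁺ ≡ suc (toℕ j) →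
    HasFactor π (inject₁ i) max (inject₁ j) → π ⟨$⟩ʳ max ≢ last × π ⟨$⟩ʳ last ≢ max
  factor-avoids-last {π} i⁺≡ j⁺≡ (πi≡max , πmax≡j) =
    (λ eq → ≢last j⁺≡ (trans (sym πmax≡j) eq)) ,
    (λ eq → ≢last i⁺≡ (⟨$⟩ʳ-injective π (trans πi≡max (sym eq))))
    where
    ≢last : ∀ {h h⁺ : Fin (suc k)} → toℕ h⁺ ≡ suc (toℕ h) → inject₁ h ≢ last
    ≢last {h} {h⁺} h⁺≡ eq = ℕ.<-irrefl
      (trans h⁺≡ (cong suc (trans (cong toℕ (inject₁-injective eq)) (toℕ-fromℕ k))))
      (toℕ<n h⁺)

  module _ (d : ℤ) {i j i⁺ j⁺ : Fin (suc k)}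
           (i⁺≡ : toℕ i⁺ ≡ suc (toℕ i)) (j⁺≡ : toℕ j⁺ ≡ suc (toℕ j)) where

    P-shift-≤ : P (suc (suc k)) d i j ≤ P (suc (suc k)) d i⁺ j⁺
    -- `∘ₚ` applies its left factor first, so the conjugate sends `x` to `shift (π ⟨$⟩ʳ unshift x)`.
    P-shift-≤ = permutations-count-≤ (inP? d i j) (inP? d i⁺ j⁺) (λ π → flip shiftₚ ∘ₚ π ∘ₚ shiftₚ)
      (λ {π} {ρ} eq x → ⟨$⟩ʳ-injective shiftₚ (begin
        shift (π ⟨$⟩ʳ x)                  ≡⟨ cong (shift ∘ (π ⟨$⟩ʳ_)) (unshift-shift x) ⟨
        shift (π ⟨$⟩ʳ unshift (shift x))  ≡⟨ eq (shift x) ⟩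
        shift (ρ ⟨$⟩ʳ unshift (shift x))  ≡⟨ cong (shift ∘ (ρ ⟨$⟩ʳ_)) (unshift-shift x) ⟩
        shift (ρ ⟨$⟩ʳ x)                  ∎))
      λ {π} {ρ} ρ≈ → λ { (p , factor@(πi≡max , πmax≡j)) →
        let avoid₁ , avoid₂ = factor-avoids-last {π} i⁺≡ j⁺≡ factor
            semi = λ x → trans (ρ≈ (shift x)) (cong (shift ∘ (π ⟨$⟩ʳ_)) (unshift-shift x))
        in
        𝒫-shift⁺ {π = π} {ρ} semi avoid₁ avoid₂ p
        , (begin
            ρ ⟨$⟩ʳ inject₁ i⁺           ≡⟨ cong (ρ ⟨$⟩ʳ_) (shift-inject₁ i⁺≡) ⟨
            ρ ⟨$⟩ʳ shift (inject₁ i)    ≡⟨ semi (inject₁ i) ⟩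
            shift (π ⟨$⟩ʳ inject₁ i)    ≡⟨ cong shift πi≡max ⟩
            shift max                   ≡⟨ shift-max ⟩
            max                         ∎)
        , (begin
            ρ ⟨$⟩ʳ max            ≡⟨ cong (ρ ⟨$⟩ʳ_) shift-max ⟨
            ρ ⟨$⟩ʳ shift max      ≡⟨ semi max ⟩
            shift (π ⟨$⟩ʳ max)    ≡⟨ cong shift πmax≡j ⟩
            shift (inject₁ j)     ≡⟨ shift-inject₁ j⁺≡ ⟩
            inject₁ j⁺            ∎) }
      where open ≡-Reasoning

    P-unshift-≤ : P (suc (suc k)) d i⁺ j⁺ ≤ P (suc (suc k)) d i j
    P-unshift-≤ = permutations-count-≤ (inP? d i⁺ j⁺) (inP? d i j) (λ ρ → shiftₚ ∘ₚ ρ ∘ₚ flip shiftₚ)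
      (λ {π} {ρ} eq x → ⟨$⟩ʳ-injective (flip shiftₚ) (begin
        unshift (π ⟨$⟩ʳ x)                  ≡⟨ cong (unshift ∘ (π ⟨$⟩ʳ_)) (shift-unshift x) ⟨
        unshift (π ⟨$⟩ʳ shift (unshift x))  ≡⟨ eq (unshift x) ⟩
        unshift (ρ ⟨$⟩ʳ shift (unshift x))  ≡⟨ cong (unshift ∘ (ρ ⟨$⟩ʳ_)) (shift-unshift x) ⟩
        unshift (ρ ⟨$⟩ʳ x)                  ∎))
      λ {ρ} {π} π≈ → λ { (p , ρi⁺≡max , ρmax≡j⁺) →
        let semi = λ x → sym (trans (cong shift (π≈ x)) (shift-unshift (ρ ⟨$⟩ʳ shift x)))
            -- The avoidance conditions are about the unshifted `π`, so its factor i n j is first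
            -- recovered from the factor of `ρ`.
            πi≡max = ⟨$⟩ʳ-injective shiftₚ (begin
              shift (π ⟨$⟩ʳ inject₁ i)  ≡⟨ semi (inject₁ i) ⟨
              ρ ⟨$⟩ʳ shift (inject₁ i)  ≡⟨ cong (ρ ⟨$⟩ʳ_) (shift-inject₁ i⁺≡) ⟩
              ρ ⟨$⟩ʳ inject₁ i⁺         ≡⟨ ρi⁺≡max ⟩
              max                       ≡⟨ shift-max ⟨
              shift max                 ∎)
            πmax≡j = ⟨$⟩ʳ-injective shiftₚ (begin
              shift (π ⟨$⟩ʳ max)  ≡⟨ semi max ⟨
              ρ ⟨$⟩ʳ shift max    ≡⟨ cong (ρ ⟨$⟩ʳ_) shift-max ⟩
              ρ ⟨$⟩ʳ max          ≡⟨ ρmax≡j⁺ ⟩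
              inject₁ j⁺          ≡⟨ shift-inject₁ j⁺≡ ⟨
              shift (inject₁ j)   ∎)
            avoid₁ , avoid₂ = factor-avoids-last {π} i⁺≡ j⁺≡ (πi≡max , πmax≡j)
        in 𝒫-shift⁻ {π = π} {ρ} semi avoid₁ avoid₂ p , πi≡max , πmax≡j }
      where open ≡-Reasoning

theorem3p2 : (n : ℕ) → 2 ≤ n → (d : ℤ) →
    ((i j : Fin (pred n)) → P n d i j ≡ P n d j i)
    × ((i j i⁺ j⁺ : Fin (pred n)) → toℕ i⁺ ≡ suc (toℕ i) → toℕ j⁺ ≡ suc (toℕ j) →
    P n d i⁺ j⁺ ≡ P n d i j)
theorem3p2 (suc (suc k)) (s≤s (s≤s z≤n)) d =
  (λ i j → ℕ.≤-antisym (P-transpose-≤ _ d i j) (P-transpose-≤ _ d j i)) ,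
  (λ i j i⁺ j⁺ i⁺≡ j⁺≡ → ℕ.≤-antisym (P-unshift-≤ d i⁺≡ j⁺≡) (P-shift-≤ d i⁺≡ j⁺≡))
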